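{- Let $\mathcal{B}$ be a building set on $[n]$ and let $$\mathcal{P}=\sum_{i\in[n]}\mathrm{Conv}(0,e_i)+\sum_{I\in\mathcal{B}}\mathrm{Conv}(\{e_S: S\subsetneq I\})\subseteq\mathbb{R}^n$$ (Minkowski sum), where $e_1,\dots,e_n$ is the standard basis and $e_S=\sum_{i\in S}e_i$ (so $e_\varnothing=0$). Then $\mathcal{P}$ is combinatorially equivalent to (has face lattice isomorphic to that of) the extended nestohedron $\mathcal{P}^{\square}(\mathcal{B})$.
   Context: A building set on $[n]$ is a collection $\mathcal{B}$ of nonempty subsets of $[n]$ containing all singletons and such that $I\cup J\in\mathcal{B}$ whenever $I,J\in\mathcal{B}$, $I\cap J\neq\varnothing$. An extended nested collection is a set $\{I_1,\dots,I_m,x_{i_1},\dots,x_{i_r}\}$ with $I_j\in\mathcal{B}$ (maximal elements allowed) and formal symbols $x_i$ ($i\in[n]$) such that the $I_j$ are pairwise nested or disjoint, no union of $k\ge2$ pairwise disjoint $I_j$'s lies in $\mathcal{B}$, and no $i_\ell$ lies in any $I_j$. The extended nested complex $\mathcal{N}^{\square}(\mathcal{B})$ (vertex set $\mathcal{B}\cup\{x_1,\dots,x_n\}$, faces the extended nested collections) is the boundary complex of an $n$-dimensional simplicial polytope; the extended nestohedron $\mathcal{P}^{\square}(\mathcal{B})$ is the polar dual simple polytope, i.e. an $n$-dimensional simple polytope whose facets correspond to the vertices of $\mathcal{N}^{\square}(\mathcal{B})$ in such a way that a set of facets has nonempty common intersection iff the corresponding vertices form an extended nested collection.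
   Formalization: The polytope P is taken as its set of rational points in Q^n, and its faces are those exposed by rational linear functionals, instead of working in R^n; since P has integral vertices its face lattice is the same. -}

module Defs where

open import Data.Nat.Base using (ℕ; zero; suc)
open import Data.Bool.Base using (Bool; true; false; T; if_then_else_; _∧_; not)
import Data.Fin.Base as Fin
open Fin using (Fin)
import Data.List.Base
import Data.Nat.Base
import Data.Bool.Properties
open import Data.Fin.Subset using (Subset; inside; outside; ⁅_⁆; _∪_; _∩_; _⊆_; _∈_; _∉_; Nonempty; Empty; ⋃)
open import Data.Vec.Base using (Vec; []; _∷_; lookup)
open import Data.List.Base using (List; []; _∷_; _++_; map; filter; length)
open import Data.List.Relation.Unary.All using (All)
open import Data.List.Relation.Unary.AllPairs using (AllPairs)
open import Data.Rational using (ℚ; 0ℚ; 1ℚ; _+_; _*_; _≤_)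
open import Data.Product using (Σ; ∃; _×_)
open import Data.Sum using (_⊎_)
open import Relation.Nullary using (¬_)
open import Relation.Binary.PropositionalEquality using (_≡_)
open import Relation.Nullary.Decidable using (Dec; yes; no)

-- Points of ℚⁿ (the polytope has rational vertices)

Pt : ℕ → Set
Pt n = Fin n → ℚ

∑ : ∀ {m} → (Fin m → ℚ) → ℚ
∑ {zero}  f = 0ℚ
∑ {suc m} f = f Fin.zero + ∑ (λ k → f (Fin.suc k))

_·_ : ∀ {n} → Pt n → Pt n → ℚ
c · x = ∑ (λ j → c j * x j)

0ᵖ : ∀ {n} → Pt n
0ᵖ _ = 0ℚ

_+ᵖ_ : ∀ {n} → Pt n → Pt n → Pt n
(x +ᵖ y) j = x j + y j

e : ∀ {n} → Subset n → Pt n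
e S j = if lookup S j then 1ℚ else 0ℚ

Conv : ∀ {n} → List (Pt n) → Pt n → Set
Conv {n} ps x =
  Σ (Fin (length ps) → ℚ) λ w →
    (∀ k → 0ℚ ≤ w k) × (∑ w ≡ 1ℚ) ×
    (∀ j → x j ≡ ∑ (λ k → w k * Data.List.Base.lookup ps k j))

Minkowski : ∀ {n} → List (Pt n → Set) → Pt n → Set
Minkowski []       x = ∀ j → x j ≡ 0ℚ
Minkowski (A ∷ As) x =
  ∃ λ a → ∃ λ b → A a × Minkowski As b × (∀ j → x j ≡ a j + b j)

allSubsets : ∀ n → List (Subset n)
allSubsets zero    = [] ∷ []
allSubsets (suc n) = map (inside ∷_) (allSubsets n) ++ map (outside ∷_) (allSubsets n)

allFins : ∀ n → List (Fin n)
allFins n = Data.List.Base.tabulate (λ i → i)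

⊆ᵇ : ∀ {n} → Subset n → Subset n → Bool
⊆ᵇ []            []       = true
⊆ᵇ (inside ∷ s)  (b ∷ t)  = b ∧ ⊆ᵇ s t
⊆ᵇ (outside ∷ s) (_ ∷ t)  = ⊆ᵇ s t

⊊ᵇ : ∀ {n} → Subset n → Subset n → Bool
⊊ᵇ S I = ⊆ᵇ S I ∧ not (⊆ᵇ I S)

record BuildingSet (n : ℕ) : Set where
  field
    B          : Subset n → Bool
    nonempty   : ∀ S → T (B S) → Nonempty S
    singletons : ∀ i → T (B ⁅ i ⁆)
    union      : ∀ I J → T (B I) → T (B J) → Nonempty (I ∩ J) → T (B (I ∪ J))

module _ {n : ℕ} (ℬ : BuildingSet n) where
  open BuildingSet ℬ

  summands : List (Pt n → Set)
  summands =
    map (λ i → Conv (0ᵖ ∷ e ⁅ i ⁆ ∷ [])) (allFins n) ++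
    map (λ I → Conv (map e (filter (λ S → Data.Bool.Properties.T? (⊊ᵇ S I)) (allSubsets n))))
        (filter (λ I → Data.Bool.Properties.T? (B I)) (allSubsets n))

  𝒫 : Pt n → Set
  𝒫 = Minkowski summands

Face : ∀ {n} → (Pt n → Set) → Pt n → Pt n → Set
Face P c x = P x × (∀ y → P y → c · y ≤ c · x)

_⊑_ : ∀ {n} → (Pt n → Set) → (Pt n → Set) → Set
F ⊑ G = ∀ x → F x → G x

-- Extended nested collections:  { I_j : Is I_j = true } ∪ { x_i : i ∈ xs }

record Collection (n : ℕ) : Set where
  constructor coll
  field
    Is : Subset n → Bool
    xs : Subset n

Disjoint : ∀ {n} → Subset n → Subset n → Set
Disjoint S T = Empty (S ∩ T)

module _ {n : ℕ} (ℬ : BuildingSet n) where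
  open BuildingSet ℬ

  record IsExtendedNested (N : Collection n) : Set where
    open Collection N
    field
      inB      : ∀ I → T (Is I) → T (B I)
      nested   : ∀ I J → T (Is I) → T (Is J) → I ⊆ J ⊎ J ⊆ I ⊎ Disjoint I J
      noUnion  : ∀ (L : List (Subset n)) → 2 Data.Nat.Base.≤ length L →
                 All (λ I → T (Is I)) L → AllPairs Disjoint L → ¬ T (B (⋃ L))
      xsOutside : ∀ i I → i ∈ xs → T (Is I) → i ∉ I

_⊆ᶜ_ : ∀ {n} → Collection n → Collection n → Set
N ⊆ᶜ M = (∀ I → T (Collection.Is N I) → T (Collection.Is M I)) ×
         (Collection.xs N ⊆ Collection.xs M)

{-# OPTIONS --safe #-}
module Submission where

-- A functional c is sent to the collection of the x_i with c_i < 0 together with the connected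
-- components (maximal members of ℬ) of the superlevel sets { c ≥ t }, t > 0.  A face of a Minkowski
-- sum is the sum of the faces of the summands, and a face of a convex hull is spanned by the maximal
-- vertices.  On Conv(0, e_i) these vertices record the sign of c_i; on the hull of the e_S, S ⊊ I,
-- they record the argmins of c over I when c is positive on I, and only signs otherwise.  So
-- inclusion of faces means refinement of signs and argmins, which is what inclusion of the attached
-- collections expresses.  An extended nested collection N is attached to the functional that is −1
-- on the x_i of N and elsewhere n + 1 − |K| for the smallest K ∈ N containing i (0 if there is none).

open import Defs
open import Algebra.Bundles using (CommutativeMonoid)
open import Data.Bool.Base using (true; false; T; if_then_else_; not)
open import Data.Bool.Properties using (T?; T-∧; T-≡)
open import Data.Fin.Base using (Fin; zero; suc)
open import Data.Fin.Properties using (any?; all?)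
open import Data.Fin.Subset using (Subset; inside; outside; ⁅_⁆; _∪_; _∩_; _-_; _⊆_; _⊂_; _∈_; _∉_; Nonempty; ⋃; ∣_∣)
open import Data.Fin.Subset.Properties
open import Data.List.Base as List using (List; []; _∷_; map; filter; length)
import Data.List.Extrema
import Data.List.Extrema.Nat as ExtremaNat
open import Data.List.Membership.Propositional using (find; lose) renaming (_∈_ to _∈ˡ_)
open import Data.List.Membership.Propositional.Properties using (∈-lookup; ∈-map⁺; ∈-map⁻; ∈-filter⁺; ∈-filter⁻; ∈-++⁺ˡ; ∈-++⁺ʳ; ∈-++⁻; ∈-tabulate⁺)
open import Data.List.Relation.Unary.All as All using (All; []; _∷_)
import Data.List.Relation.Unary.All.Properties as All
open import Data.List.Relation.Unary.AllPairs using (AllPairs; []; _∷_)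
import Data.List.Relation.Unary.AllPairs.Properties as AllPairs
open import Data.List.Relation.Unary.Any as Any using (here; there)
open import Data.Nat.Base as ℕ using (ℕ; zero; suc; _∸_; s≤s; z≤n)
import Data.Nat.Properties as ℕ
open import Data.Product using (Σ; ∃; _×_; _,_; proj₁; proj₂)
open import Data.Rational using (ℚ; 0ℚ; 1ℚ; _+_; _*_; -_; _≤_; _<_; nonNegative; positive)
open import Data.Rational.Properties
open import Data.Sum.Base using (_⊎_; inj₁; inj₂)
open import Data.Vec.Base using ([]; _∷_; here; there; tabulate)
open import Data.Vec.Properties using ([]=⇒lookup; lookup⇒[]=; lookup∘tabulate)
open import Function.Base using (_∘_; id)
open import Function.Bundles using (_⇔_; mk⇔; module Equivalence)
open import Relation.Binary.Bundles using (DecTotalOrder)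
open import Relation.Binary.PropositionalEquality
open import Relation.Nullary using (¬_; Dec; yes; no; contradiction)
open import Relation.Nullary.Decidable using (⌊_⌋; toWitness; fromWitness; _×-dec_; _→-dec_; ¬?; map′; decidable-stable)
open import Relation.Unary using (Decidable)

open import Algebra.Properties.CommutativeSemigroup (CommutativeMonoid.commutativeSemigroup +-0-commutativeMonoid) using (interchange)

module Extrema = Data.List.Extrema (DecTotalOrder.totalOrder ≤-decTotalOrder)

private
  variable
    m n : ℕ

-- Cancellation, finite sums and linearity of the pairing

+-cancelˡ-≤ : ∀ r {p q} → r + p ≤ r + q → p ≤ q
+-cancelˡ-≤ r rp≤rq = ≮⇒≥ λ q<p → <-irrefl refl (<-≤-trans (+-monoʳ-< r q<p) rp≤rq)

+-cancelʳ-≤ : ∀ r {p q} → p + r ≤ q + r → p ≤ q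
+-cancelʳ-≤ r {p} {q} h = +-cancelˡ-≤ r (subst₂ _≤_ (+-comm p r) (+-comm q r) h)

∑-cong : {f g : Fin m → ℚ} → (∀ k → f k ≡ g k) → ∑ f ≡ ∑ g
∑-cong {zero}  eq = refl
∑-cong {suc m} eq = cong₂ _+_ (eq zero) (∑-cong (eq ∘ suc))

∑-zero : ∀ m → ∑ {m} (λ _ → 0ℚ) ≡ 0ℚ
∑-zero zero    = refl
∑-zero (suc m) = trans (+-identityˡ _) (∑-zero m)

∑-distrib-+ : (f g : Fin m → ℚ) → ∑ (λ k → f k + g k) ≡ ∑ f + ∑ g
∑-distrib-+ {zero}  f g = refl
∑-distrib-+ {suc m} f g =
  trans (cong (f zero + g zero +_) (∑-distrib-+ (f ∘ suc) (g ∘ suc)))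
        (interchange (f zero) (g zero) (∑ (f ∘ suc)) (∑ (g ∘ suc)))

*-distribˡ-∑ : ∀ r (f : Fin m → ℚ) → r * ∑ f ≡ ∑ (λ k → r * f k)
*-distribˡ-∑ {zero}  r f = *-zeroʳ r
*-distribˡ-∑ {suc m} r f =
  trans (*-distribˡ-+ r (f zero) (∑ (f ∘ suc))) (cong (r * f zero +_) (*-distribˡ-∑ r (f ∘ suc)))

*-distribʳ-∑ : ∀ r (f : Fin m → ℚ) → ∑ f * r ≡ ∑ (λ k → f k * r)
*-distribʳ-∑ r f =
  trans (*-comm (∑ f) r) (trans (*-distribˡ-∑ r f) (∑-cong λ k → *-comm r (f k)))

∑-comm : (f : Fin m → Fin n → ℚ) → ∑ (λ i → ∑ (f i)) ≡ ∑ (λ j → ∑ (λ i → f i j))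
∑-comm {zero}  {n} f = sym (∑-zero n)
∑-comm {suc m} {n} f =
  trans (cong (∑ (f zero) +_) (∑-comm (f ∘ suc)))
        (sym (∑-distrib-+ (f zero) (λ j → ∑ (λ i → f (suc i) j))))

∑-mono-≤ : {f g : Fin m → ℚ} → (∀ k → f k ≤ g k) → ∑ f ≤ ∑ g
∑-mono-≤ {zero}  f≤g = ≤-refl
∑-mono-≤ {suc m} f≤g = +-mono-≤ (f≤g zero) (∑-mono-≤ (f≤g ∘ suc))

∑-mono-< : {f g : Fin m → ℚ} → (∀ k → f k ≤ g k) → ∀ k → f k < g k → ∑ f < ∑ g
∑-mono-< f≤g zero    f<g = +-mono-<-≤ f<g (∑-mono-≤ (f≤g ∘ suc))
∑-mono-< f≤g (suc k) f<g = +-mono-≤-< (f≤g zero) (∑-mono-< (f≤g ∘ suc) k f<g)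

·-cong : (c : Pt n) {x y : Pt n} → (∀ j → x j ≡ y j) → c · x ≡ c · y
·-cong c eq = ∑-cong λ j → cong (c j *_) (eq j)

·-+ᵖ : (c x y : Pt n) → c · (x +ᵖ y) ≡ c · x + c · y
·-+ᵖ c x y = trans (∑-cong λ j → *-distribˡ-+ (c j) (x j) (y j)) (∑-distrib-+ (λ j → c j * x j) (λ j → c j * y j))

·-0ᵖ : (c : Pt n) → c · 0ᵖ ≡ 0ℚ
·-0ᵖ {n} c = trans (∑-cong λ j → *-zeroʳ (c j)) (∑-zero n)

·-∑ : (c : Pt n) (w : Fin m → ℚ) (p : Fin m → Pt n) →
      c · (λ j → ∑ (λ k → w k * p k j)) ≡ ∑ (λ k → w k * (c · p k))
·-∑ c w p = begin
  ∑ (λ j → c j * ∑ (λ k → w k * p k j))    ≡⟨ ∑-cong (λ j → *-distribˡ-∑ (c j) (λ k → w k * p k j)) ⟩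
  ∑ (λ j → ∑ (λ k → c j * (w k * p k j)))  ≡⟨ ∑-comm (λ j k → c j * (w k * p k j)) ⟩
  ∑ (λ k → ∑ (λ j → c j * (w k * p k j)))  ≡⟨ ∑-cong (λ k → ∑-cong λ j → swap (c j) (w k) (p k j)) ⟩
  ∑ (λ k → ∑ (λ j → w k * (c j * p k j)))  ≡⟨ ∑-cong (λ k → *-distribˡ-∑ (w k) (λ j → c j * p k j)) ⟨
  ∑ (λ k → w k * (c · p k))                ∎
  where
  open ≡-Reasoning
  swap : ∀ x y z → x * (y * z) ≡ y * (x * z)
  swap x y z = trans (sym (*-assoc x y z)) (trans (cong (_* z) (*-comm x y)) (*-assoc y x z))

-- Faces of Minkowski sums

·-split : (c : Pt n) {x a b : Pt n} → (∀ j → x j ≡ a j + b j) → c · x ≡ c · a + c · b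
·-split c {a = a} {b} eq = trans (·-cong c eq) (·-+ᵖ c a b)

module _ (A : Pt n → Set) (As : List (Pt n → Set)) (c : Pt n) {x a b : Pt n}
         (x≡a+b : ∀ j → x j ≡ a j + b j) where

  Face-∷⁺ : Face A c a → Face (Minkowski As) c b → Face (Minkowski (A ∷ As)) c x
  Face-∷⁺ (Aa , a-max) (Ab , b-max) = (a , b , Aa , Ab , x≡a+b) ,
    λ { y (a′ , b′ , Aa′ , Ab′ , y≡) →
        subst₂ _≤_ (sym (·-split c y≡)) (sym (·-split c x≡a+b))
               (+-mono-≤ (a-max a′ Aa′) (b-max b′ Ab′)) }

  -- Varying one term while the other stays fixed gives competitors of `x`, and the common term
  -- cancels. So every decomposition of a maximal `x` has maximal terms.
  Face-∷⁻ : A a → Minkowski As b → Face (Minkowski (A ∷ As)) c x →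
            Face A c a × Face (Minkowski As) c b
  Face-∷⁻ Aa Ab (_ , x-max) =
    (Aa , λ a′ Aa′ → +-cancelʳ-≤ (c · b) (subst₂ _≤_ (·-+ᵖ c a′ b) (·-split c x≡a+b)
                       (x-max (a′ +ᵖ b) (a′ , b , Aa′ , Ab , λ _ → refl)))) ,
    (Ab , λ b′ Ab′ → +-cancelˡ-≤ (c · a) (subst₂ _≤_ (·-+ᵖ c a b′) (·-split c x≡a+b)
                       (x-max (a +ᵖ b′) (a , b′ , Aa , Ab′ , λ _ → refl))))

Face-Minkowski-mono : (As : List (Pt n → Set)) (c d : Pt n) →
  (∀ {A} → A ∈ˡ As → Face A c ⊑ Face A d) → Face (Minkowski As) c ⊑ Face (Minkowski As) d
Face-Minkowski-mono []       c d _ x (x≡0 , _) =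
  x≡0 , λ y y≡0 → ≤-reflexive (·-cong d λ j → trans (y≡0 j) (sym (x≡0 j)))
Face-Minkowski-mono (A ∷ As) c d h x x∈@((a , b , Aa , Ab , x≡) , _)
  with Face-∷⁻ A As c x≡ Aa Ab x∈
... | a∈ , b∈ = Face-∷⁺ A As d x≡ (h (here refl) a a∈)
                  (Face-Minkowski-mono As c d (h ∘ there) b b∈)

Face-Minkowski-nonempty : (As : List (Pt n → Set)) (c : Pt n) →
  (∀ {A} → A ∈ˡ As → ∃ (Face A c)) → ∃ (Face (Minkowski As) c)
Face-Minkowski-nonempty []       c _  =
  0ᵖ , (λ _ → refl) , λ y y≡0 → ≤-reflexive (·-cong c y≡0)
Face-Minkowski-nonempty (A ∷ As) c ne
  with a , a∈ ← ne (here refl) | b , b∈ ← Face-Minkowski-nonempty As c (ne ∘ there)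
  = a +ᵖ b , Face-∷⁺ A As c (λ _ → refl) a∈ b∈

-- Pad `a` with a maximiser `b` of the other summands: `a +ᵖ b` lies on the face of `c`, hence on
-- that of `d`, and splitting it again puts `a` on the `d`-face of its own summand.
Face-summand-mono : (As : List (Pt n → Set)) (c d : Pt n) →
  (∀ {A} → A ∈ˡ As → ∃ (Face A c)) →
  Face (Minkowski As) c ⊑ Face (Minkowski As) d → ∀ {A} → A ∈ˡ As → Face A c ⊑ Face A d
Face-summand-mono (A ∷ As) c d ne h (here refl) a a∈@(Aa , _)
  with b , b∈@(Ab , _) ← Face-Minkowski-nonempty As c (ne ∘ there)
  = proj₁ (Face-∷⁻ A As d (λ _ → refl) Aa Ab
      (h (a +ᵖ b) (Face-∷⁺ A As c (λ _ → refl) a∈ b∈)))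
Face-summand-mono (A ∷ As) c d ne h (there A′∈As) with a , a∈@(Aa , _) ← ne (here refl)
  = Face-summand-mono As c d (ne ∘ there)
      (λ b b∈@(Ab , _) → proj₂ (Face-∷⁻ A As d (λ _ → refl) Aa Ab
        (h (a +ᵖ b) (Face-∷⁺ A As c (λ _ → refl) a∈ b∈))))
      A′∈As

-- Faces of convex hulls

IsMaxVertex : List (Pt n) → Pt n → Pt n → Set
IsMaxVertex ps c p = p ∈ˡ ps × (∀ {q} → q ∈ˡ ps → c · q ≤ c · p)

Conv-vertex : {ps : List (Pt n)} {p : Pt n} → p ∈ˡ ps → Conv ps p
Conv-vertex {ps = p ∷ ps} (here refl) =
  (λ { zero → 1ℚ ; (suc _) → 0ℚ }) ,
  (λ { zero → <⇒≤ (positive⁻¹ 1ℚ) ; (suc _) → ≤-refl }) ,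
  trans (cong (1ℚ +_) (∑-zero (length ps))) (+-identityʳ 1ℚ) ,
  λ j → sym (trans (cong₂ _+_ (*-identityˡ (p j))
                     (trans (∑-cong λ k → *-zeroˡ (List.lookup ps k j)) (∑-zero (length ps))))
                   (+-identityʳ (p j)))
Conv-vertex {ps = q ∷ ps} (there p∈ps) with w , w≥0 , ∑w≡1 , p≡ ← Conv-vertex p∈ps =
  (λ { zero → 0ℚ ; (suc k) → w k }) ,
  (λ { zero → ≤-refl ; (suc k) → w≥0 k }) ,
  trans (+-identityˡ _) ∑w≡1 ,
  λ j → trans (p≡ j) (sym (trans (cong (_+ ∑ (λ k → w k * List.lookup ps k j)) (*-zeroˡ (q j))) (+-identityˡ _)))

module _ {ps : List (Pt n)} where

  Conv-≤ : (c : Pt n) {M : ℚ} → (∀ {q} → q ∈ˡ ps → c · q ≤ M) → ∀ {y} → Conv ps y → c · y ≤ M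
  Conv-≤ c {M} c·q≤M {y} (w , w≥0 , ∑w≡1 , y≡) = begin
    c · y                                  ≡⟨ trans (·-cong c y≡) (·-∑ c w (List.lookup ps)) ⟩
    ∑ (λ k → w k * (c · List.lookup ps k)) ≤⟨ ∑-mono-≤ (λ k → *-monoˡ-≤-nonNeg (w k) {{nonNegative (w≥0 k)}} (c·q≤M (∈-lookup k))) ⟩
    ∑ (λ k → w k * M)                      ≡⟨ *-distribʳ-∑ M w ⟨
    ∑ w * M                                ≡⟨ cong (_* M) ∑w≡1 ⟩
    1ℚ * M                                 ≡⟨ *-identityˡ M ⟩
    M                                      ∎
    where open ≤-Reasoning

  maxVertex⇒Face : (c : Pt n) {p : Pt n} → IsMaxVertex ps c p → Face (Conv ps) c p
  maxVertex⇒Face c (p∈ps , p-max) = Conv-vertex p∈ps , λ y → Conv-≤ c p-max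

  maxVertex-exists : (c : Pt n) {p : Pt n} → p ∈ˡ ps → ∃ (IsMaxVertex ps c)
  maxVertex-exists c {p} p∈ps =
    Extrema.argmax (c ·_) p ps ,
    Extrema.argmax-all (c ·_) {P = _∈ˡ ps} p∈ps (All.tabulate id) ,
    All.lookup (Extrema.f[xs]≤f[argmax] {f = c ·_} p ps)

  -- In a point of the `c`-face only `c`-maximal vertices carry positive weight. If these are
  -- `d`-maximal, no vertex beats their average under `d`.
  Face-Conv-mono⁺ : (c d : Pt n) → (∀ {p} → IsMaxVertex ps c p → IsMaxVertex ps d p) →
                    Face (Conv ps) c ⊑ Face (Conv ps) d
  Face-Conv-mono⁺ c d h x (Px@(w , w≥0 , ∑w≡1 , x≡) , x-max) =
    Px , λ y → Conv-≤ d vertex≤x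
    where
    P : Fin (length ps) → Pt n
    P = List.lookup ps

    c·x≡ : c · x ≡ ∑ (λ k → w k * (c · P k))
    c·x≡ = trans (·-cong c x≡) (·-∑ c w P)

    -- A vertex of positive weight lying strictly below c · x would drag the average below c · x.
    supported : ∀ k → 0ℚ < w k → IsMaxVertex ps c (P k)
    supported k wk>0 = ∈-lookup k , λ {q} q∈ps →
      ≤-trans (x-max q (Conv-vertex q∈ps)) (≮⇒≥ λ c·Pk<c·x →
        <-irrefl (trans (sym c·x≡) (sym ∑w*M≡M))
          (∑-mono-< {f = λ l → w l * (c · P l)} {g = λ l → w l * (c · x)}
            (λ l → *-monoˡ-≤-nonNeg (w l) {{nonNegative (w≥0 l)}}
                     (x-max (P l) (Conv-vertex {ps = ps} (∈-lookup l))))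
            k (*-monoʳ-<-pos (w k) {{positive wk>0}} c·Pk<c·x)))
      where
      ∑w*M≡M : ∑ (λ l → w l * (c · x)) ≡ c · x
      ∑w*M≡M = trans (sym (*-distribʳ-∑ (c · x) w)) (trans (cong (_* (c · x)) ∑w≡1) (*-identityˡ _))

    weighted : ∀ {q} → q ∈ˡ ps → ∀ k → w k * (d · q) ≤ w k * (d · P k)
    weighted {q} q∈ps k with 0ℚ <? w k
    ... | yes wk>0 = *-monoˡ-≤-nonNeg (w k) {{nonNegative (w≥0 k)}} (proj₂ (h (supported k wk>0)) q∈ps)
    ... | no  wk≯0 = ≤-reflexive (trans (cong (_* (d · q)) wk≡0) (trans (*-zeroˡ (d · q))
                       (sym (trans (cong (_* (d · P k)) wk≡0) (*-zeroˡ (d · P k))))))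
      where
      wk≡0 : w k ≡ 0ℚ
      wk≡0 = ≤-antisym (≮⇒≥ wk≯0) (w≥0 k)

    vertex≤x : ∀ {q} → q ∈ˡ ps → d · q ≤ d · x
    vertex≤x {q} q∈ps = begin
      d · q                       ≡⟨ *-identityˡ (d · q) ⟨
      1ℚ * (d · q)                ≡⟨ cong (_* (d · q)) ∑w≡1 ⟨
      ∑ w * (d · q)               ≡⟨ *-distribʳ-∑ (d · q) w ⟩
      ∑ (λ k → w k * (d · q))     ≤⟨ ∑-mono-≤ (weighted q∈ps) ⟩
      ∑ (λ k → w k * (d · P k))   ≡⟨ trans (·-cong d x≡) (·-∑ d w P) ⟨
      d · x                       ∎
      where open ≤-Reasoning

  Face-Conv-mono⁻ : (c d : Pt n) → Face (Conv ps) c ⊑ Face (Conv ps) d →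
                    ∀ {p} → IsMaxVertex ps c p → IsMaxVertex ps d p
  Face-Conv-mono⁻ c d h {p} p-max =
    proj₁ p-max , λ {q} q∈ps → proj₂ (h p (maxVertex⇒Face c p-max)) q (Conv-vertex q∈ps)

-- Maximising over the proper subsets of a set

e-∈ : {S : Subset n} {j : Fin n} → j ∈ S → e S j ≡ 1ℚ
e-∈ j∈S = cong (if_then 1ℚ else 0ℚ) ([]=⇒lookup j∈S)

e-∉ : {S : Subset n} {j : Fin n} → j ∉ S → e S j ≡ 0ℚ
e-∉ {S = inside  ∷ S} {zero}  j∉S = contradiction here j∉S
e-∉ {S = outside ∷ S} {zero}  j∉S = refl
e-∉ {S = _ ∷ S}       {suc j} j∉S = e-∉ (j∉S ∘ there)

*e-∈ : (c : Pt n) {S : Subset n} {j : Fin n} → j ∈ S → c j * e S j ≡ c j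
*e-∈ c {j = j} j∈S = trans (cong (c j *_) (e-∈ j∈S)) (*-identityʳ (c j))

*e-∉ : (c : Pt n) {S : Subset n} {j : Fin n} → j ∉ S → c j * e S j ≡ 0ℚ
*e-∉ c {j = j} j∉S = trans (cong (c j *_) (e-∉ j∉S)) (*-zeroʳ (c j))

x∉p-x : (p : Subset n) (x : Fin n) → x ∉ p - x
x∉p-x (_ ∷ p) zero    ()
x∉p-x (_ ∷ p) (suc x) (there x∈p-x) = x∉p-x p x x∈p-x

p-x⊆p : (p : Subset n) (x : Fin n) → p - x ⊆ p
p-x⊆p p x = p─q⊆p p ⁅ x ⁆

module _ (c : Pt n) {S U : Subset n} where

  *e-mono-≤ : ∀ j → (j ∈ S → j ∉ U → c j ≤ 0ℚ) → (j ∉ S → j ∈ U → 0ℚ ≤ c j) →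
              c j * e S j ≤ c j * e U j
  *e-mono-≤ j out inn with j ∈? S | j ∈? U
  ... | yes j∈S | yes j∈U = ≤-reflexive (trans (*e-∈ c j∈S) (sym (*e-∈ c j∈U)))
  ... | yes j∈S | no  j∉U = subst₂ _≤_ (sym (*e-∈ c j∈S)) (sym (*e-∉ c j∉U)) (out j∈S j∉U)
  ... | no  j∉S | yes j∈U = subst₂ _≤_ (sym (*e-∉ c j∉S)) (sym (*e-∈ c j∈U)) (inn j∉S j∈U)
  ... | no  j∉S | no  j∉U = ≤-reflexive (trans (*e-∉ c j∉S) (sym (*e-∉ c j∉U)))

  module _ (out : ∀ j → j ∈ S → j ∉ U → c j ≤ 0ℚ) (inn : ∀ j → j ∉ S → j ∈ U → 0ℚ ≤ c j) where

    ·e-mono-≤ : c · e S ≤ c · e U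
    ·e-mono-≤ = ∑-mono-≤ λ j → *e-mono-≤ j (out j) (inn j)

    ·e-insert-< : ∀ {j} → j ∉ S → j ∈ U → 0ℚ < c j → c · e S < c · e U
    ·e-insert-< {j} j∉S j∈U cj>0 = ∑-mono-< (λ j → *e-mono-≤ j (out j) (inn j)) j
      (subst₂ _<_ (sym (*e-∉ c j∉S)) (sym (*e-∈ c j∈U)) cj>0)

    ·e-remove-< : ∀ {j} → j ∈ S → j ∉ U → c j < 0ℚ → c · e S < c · e U
    ·e-remove-< {j} j∈S j∉U cj<0 = ∑-mono-< (λ j → *e-mono-≤ j (out j) (inn j)) j
      (subst₂ _<_ (sym (*e-∈ c j∈S)) (sym (*e-∉ c j∉U)) cj<0)

·e-⁅⁆ : (c : Pt n) (j : Fin n) → c · e ⁅ j ⁆ ≡ c j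
·e-⁅⁆ {suc n} c zero =
  trans (cong₂ _+_ (*-identityʳ (c zero))
          (trans (∑-cong λ k → *e-∉ (c ∘ suc) (∉⊥ {x = k})) (∑-zero n)))
        (+-identityʳ (c zero))
·e-⁅⁆ c (suc j) =
  trans (cong₂ _+_ (*-zeroʳ (c zero)) (·e-⁅⁆ (c ∘ suc) j)) (+-identityˡ (c (suc j)))

·e-remove : (c : Pt n) {S : Subset n} {j : Fin n} → j ∈ S → c · e S ≡ c j + c · e (S - j)
·e-remove c {S} {j} j∈S = trans (·-split c split) (cong (_+ c · e (S - j)) (·e-⁅⁆ c j))
  where
  split : ∀ k → e S k ≡ e ⁅ j ⁆ k + e (S - j) k
  split k with k ∈? ⁅ j ⁆ | k ∈? S
  ... | yes k∈j | _ rewrite x∈⁅y⁆⇒x≡y j k∈j =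
    trans (e-∈ j∈S) (sym (cong₂ _+_ (e-∈ (x∈⁅x⁆ j)) (e-∉ (x∉p-x S j))))
  ... | no k∉j | yes k∈S =
    trans (e-∈ k∈S) (sym (cong₂ _+_ (e-∉ k∉j) (e-∈ (x∈p∧x∉q⇒x∈p─q k∈S k∉j))))
  ... | no k∉j | no  k∉S =
    trans (e-∉ k∉S) (sym (cong₂ _+_ (e-∉ k∉j) (e-∉ (k∉S ∘ p-x⊆p S j))))

module _ (c : Pt n) {S : Subset n} {i k : Fin n} (i∈S : i ∈ S) (k∈S : k ∈ S) where

  private
    removals-agree : c k + c · e (S - k) ≡ c i + c · e (S - i)
    removals-agree = trans (sym (·e-remove c k∈S)) (·e-remove c i∈S)

  -- Both sides of `removals-agree` equal `c · e S`, so removing a smaller coordinate leaves a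
  -- larger remainder.
  ·e-remove-≤⁺ : c i ≤ c k → c · e (S - k) ≤ c · e (S - i)
  ·e-remove-≤⁺ ci≤ck = ≮⇒≥ λ lt → <-irrefl (sym removals-agree) (+-mono-≤-< ci≤ck lt)

  ·e-remove-≤⁻ : c · e (S - k) ≤ c · e (S - i) → c i ≤ c k
  ·e-remove-≤⁻ le = ≮⇒≥ λ lt → <-irrefl removals-agree (+-mono-<-≤ lt le)

⊂-remove : {S I : Subset n} {k : Fin n} → S ⊆ I → k ∉ S → S ⊆ I - k
⊂-remove S⊆I k∉S j∈S = x∈p∧x≢y⇒x∈p-y (S⊆I j∈S) λ { refl → k∉S j∈S }

IsMaxSubset : Pt n → Subset n → Subset n → Set
IsMaxSubset c I S = S ⊂ I × (∀ {U} → U ⊂ I → c · e U ≤ c · e S)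

IsArgmin : Pt n → Subset n → Fin n → Set
IsArgmin c I i = i ∈ I × (∀ {j} → j ∈ I → c i ≤ c j)

-- A proper subset misses some `k`. Filling it up to `I - k` loses nothing because `c` is
-- nonnegative on `I`, and removing an argmin instead of `k` is at least as good.
argmin⇒maxSubset : (c : Pt n) {I : Subset n} {i : Fin n} →
  (∀ {j} → j ∈ I → 0ℚ ≤ c j) → IsArgmin c I i → IsMaxSubset c I (I - i)
argmin⇒maxSubset c {I} {i} c≥0 (i∈I , i-min) = x∈p⇒p-x⊂p i∈I , λ { {U} (U⊆I , k , k∈I , k∉U) →
  ≤-trans (·e-mono-≤ c (λ j j∈U j∉ → contradiction (⊂-remove U⊆I k∉U j∈U) j∉)
                       (λ j _ j∈ → c≥0 (p-x⊆p I k j∈)))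
          (·e-remove-≤⁺ c i∈I k∈I (i-min k∈I)) }

maxSubset⇒argmin : (c : Pt n) {I : Subset n} {i : Fin n} →
  i ∈ I → IsMaxSubset c I (I - i) → IsArgmin c I i
maxSubset⇒argmin c i∈I (_ , max) = i∈I , λ j∈I → ·e-remove-≤⁻ c i∈I j∈I (max (x∈p⇒p-x⊂p j∈I))

-- `S` misses some `k`; missing a second element `j` would forfeit `c j > 0`, although `I - k` is
-- still proper.
maxSubset-positive : (c : Pt n) {I S : Subset n} → (∀ {j} → j ∈ I → 0ℚ < c j) →
  IsMaxSubset c I S → ∃ λ k → k ∈ I × S ≡ I - k
maxSubset-positive c {I} {S} c>0 ((S⊆I , k , k∈I , k∉S) , max) =
  k , k∈I , ⊆-antisym (⊂-remove S⊆I k∉S) I-k⊆S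
  where
  I-k⊆S : I - k ⊆ S
  I-k⊆S {j} j∈I-k with j ∈? S
  ... | yes j∈S = j∈S
  ... | no  j∉S = contradiction (max (x∈p⇒p-x⊂p k∈I)) (λ le → <-irrefl refl (<-≤-trans
    (·e-insert-< c (λ l l∈S l∉ → contradiction (⊂-remove S⊆I k∉S l∈S) l∉)
                   (λ l _ l∈ → <⇒≤ (c>0 (p-x⊆p I k l∈))) j∉S j∈I-k (c>0 (p-x⊆p I k j∈I-k))) le))

maxSubset-nonneg : (c : Pt n) {I S : Subset n} → IsMaxSubset c I S → ∀ {j} → j ∈ S → 0ℚ ≤ c j
maxSubset-nonneg c {I} {S} ((S⊆I , k , k∈I , k∉S) , max) {j} j∈S = ≮⇒≥ λ cj<0 →
  <-irrefl refl (<-≤-trans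
    (·e-remove-< c (λ l l∈S l∉ → small l∈S l∉ cj<0) (λ l l∉S l∈ → contradiction (p-x⊆p S j l∈) l∉S)
       j∈S (x∉p-x S j) cj<0)
    (max {S - j} (S⊆I ∘ p-x⊆p S j , k , k∈I , k∉S ∘ p-x⊆p S j)))
  where
  small : ∀ {l} → l ∈ S → l ∉ S - j → c j < 0ℚ → c l ≤ 0ℚ
  small {l} l∈S l∉ cj<0 with l ∈? ⁅ j ⁆
  ... | yes l∈j rewrite x∈⁅y⁆⇒x≡y j l∈j = <⇒≤ cj<0
  ... | no  l∉j = contradiction (x∈p∧x∉q⇒x∈p─q l∈S l∉j) l∉

-- A positive `j` outside `S` would be worth adding. As `S ∪ ⁅ j ⁆` might be all of `I`, the
-- competitor `S′` also drops `k`, which costs nothing since `c k ≤ 0` and keeps it proper.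
maxSubset-nonpos : (c : Pt n) {I S : Subset n} {k : Fin n} → k ∈ I → c k ≤ 0ℚ →
  IsMaxSubset c I S → ∀ {j} → j ∈ I → j ∉ S → c j ≤ 0ℚ
maxSubset-nonpos c {I} {S} {k} k∈I ck≤0 ((S⊆I , _) , max) {j} j∈I j∉S = ≮⇒≥ λ cj>0 →
  <-irrefl refl (<-≤-trans
    (·e-insert-< c {S} {S′} out (inn cj>0) j∉S
      (x∈p∧x≢y⇒x∈p-y (q⊆p∪q S ⁅ j ⁆ (x∈⁅x⁆ j)) λ { refl → <-irrefl refl (<-≤-trans cj>0 ck≤0) })
      cj>0)
    (max {S′} (S′⊆I , k , k∈I , x∉p-x (S ∪ ⁅ j ⁆) k)))
  where
  S′ : Subset _
  S′ = (S ∪ ⁅ j ⁆) - k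

  S′⊆I : S′ ⊆ I
  S′⊆I l∈S′ with x∈p∪q⁻ S ⁅ j ⁆ (p-x⊆p (S ∪ ⁅ j ⁆) k l∈S′)
  ... | inj₁ l∈S = S⊆I l∈S
  ... | inj₂ l∈j rewrite x∈⁅y⁆⇒x≡y j l∈j = j∈I

  out : ∀ l → l ∈ S → l ∉ S′ → c l ≤ 0ℚ
  out l l∈S l∉S′ with l ∈? ⁅ k ⁆
  ... | yes l∈k rewrite x∈⁅y⁆⇒x≡y k l∈k = ck≤0
  ... | no  l∉k = contradiction (x∈p∧x∉q⇒x∈p─q (p⊆p∪q ⁅ j ⁆ l∈S) l∉k) l∉S′

  inn : 0ℚ < c j → ∀ l → l ∉ S → l ∈ S′ → 0ℚ ≤ c l
  inn cj>0 l l∉S l∈S′ with x∈p∪q⁻ S ⁅ j ⁆ (p-x⊆p (S ∪ ⁅ j ⁆) k l∈S′)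
  ... | inj₁ l∈S = contradiction l∈S l∉S
  ... | inj₂ l∈j rewrite x∈⁅y⁆⇒x≡y j l∈j = <⇒≤ cj>0

module _ (c d : Pt n) {I : Subset n}
         (pos : ∀ i → 0ℚ < d i → 0ℚ < c i) (neg : ∀ i → d i < 0ℚ → c i < 0ℚ)
         (arg : (∀ {i} → i ∈ I → 0ℚ < c i) → ∀ {i} → IsArgmin c I i → IsArgmin d I i) where

  private
    nonneg : ∀ {i} → 0ℚ ≤ c i → 0ℚ ≤ d i
    nonneg {i} ci≥0 = ≮⇒≥ λ di<0 → <-irrefl refl (≤-<-trans ci≥0 (neg i di<0))

    nonpos : ∀ {i} → c i ≤ 0ℚ → d i ≤ 0ℚ
    nonpos {i} ci≤0 = ≮⇒≥ λ di>0 → <-irrefl refl (<-≤-trans (pos i di>0) ci≤0)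

  -- If `c` is nonpositive somewhere on `I`, a maximal `S` has `c ≥ 0` inside and `c ≤ 0` on the
  -- rest of `I`; these weak signs pass to `d` and suffice there. Otherwise `S` is `I` minus an
  -- argmin, and `arg` applies.
  maxSubset-mono : ∀ {S} → IsMaxSubset c I S → IsMaxSubset d I S
  maxSubset-mono {S} S-max with any? (λ k → k ∈? I ×-dec c k ≤? 0ℚ)
  ... | yes (k , k∈I , ck≤0) = proj₁ S-max , λ {U} U⊂I → ·e-mono-≤ d
          (λ j j∈U j∉S → nonpos (maxSubset-nonpos c k∈I ck≤0 S-max (proj₁ U⊂I j∈U) j∉S))
          (λ j _ j∈S → nonneg (maxSubset-nonneg c S-max j∈S))
  ... | no ¬nonpos =
    let k , k∈I , S≡I-k = maxSubset-positive c c>0 S-max in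
    subst (IsMaxSubset d I) (sym S≡I-k) (argmin⇒maxSubset d (nonneg ∘ <⇒≤ ∘ c>0)
      (arg c>0 (maxSubset⇒argmin c k∈I (subst (IsMaxSubset c I) S≡I-k S-max))))
    where
    c>0 : ∀ {i} → i ∈ I → 0ℚ < c i
    c>0 i∈I = ≰⇒> λ ci≤0 → ¬nonpos (_ , i∈I , ci≤0)

-- Boolean inclusion tests and the enumeration of subsets

⊆ᵇ⇒⊆ : (S U : Subset n) → T (⊆ᵇ S U) → S ⊆ U
⊆ᵇ⇒⊆ (inside  ∷ S) (inside ∷ U) S⊆U here        = here
⊆ᵇ⇒⊆ (inside  ∷ S) (inside ∷ U) S⊆U (there x∈S) = there (⊆ᵇ⇒⊆ S U S⊆U x∈S)
⊆ᵇ⇒⊆ (outside ∷ S) (_      ∷ U) S⊆U (there x∈S) = there (⊆ᵇ⇒⊆ S U S⊆U x∈S)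

⊆⇒⊆ᵇ : (S U : Subset n) → S ⊆ U → T (⊆ᵇ S U)
⊆⇒⊆ᵇ []            []            S⊆U = _
⊆⇒⊆ᵇ (inside  ∷ S) (inside  ∷ U) S⊆U = ⊆⇒⊆ᵇ S U (drop-∷-⊆ S⊆U)
⊆⇒⊆ᵇ (inside  ∷ S) (outside ∷ U) S⊆U = contradiction (S⊆U here) λ ()
⊆⇒⊆ᵇ (outside ∷ S) (_       ∷ U) S⊆U = ⊆⇒⊆ᵇ S U (drop-∷-⊆ S⊆U)

T-not : ∀ b → T (not b) ⇔ (¬ T b)
T-not false = mk⇔ (λ _ ()) _
T-not true  = mk⇔ (λ ()) (λ ¬t → ¬t _)

⊈⇒∃ : {S U : Subset n} → ¬ (S ⊆ U) → ∃ λ x → x ∈ S × x ∉ U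
⊈⇒∃ {S = S} {U} S⊈U with any? (λ x → x ∈? S ×-dec ¬? (x ∈? U))
... | yes found = found
... | no  none  = contradiction (λ {x} x∈S → decidable-stable (x ∈? U) λ x∉U → none (x , x∈S , x∉U)) S⊈U

⊊ᵇ⇒⊂ : (S I : Subset n) → T (⊊ᵇ S I) → S ⊂ I
⊊ᵇ⇒⊂ S I S⊊I with S⊆I , I⊈S ← Equivalence.to T-∧ S⊊I =
  ⊆ᵇ⇒⊆ S I S⊆I , ⊈⇒∃ (Equivalence.to (T-not _) I⊈S ∘ ⊆⇒⊆ᵇ I S)

⊂⇒⊊ᵇ : {S I : Subset n} → S ⊂ I → T (⊊ᵇ S I)
⊂⇒⊊ᵇ {S = S} {I} (S⊆I , x , x∈I , x∉S) = Equivalence.from T-∧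
  (⊆⇒⊆ᵇ S I S⊆I , Equivalence.from (T-not _) λ I⊆S → x∉S (⊆ᵇ⇒⊆ I S I⊆S x∈I))

∈-allSubsets : (S : Subset n) → S ∈ˡ allSubsets n
∈-allSubsets []            = here refl
∈-allSubsets (inside  ∷ S) = ∈-++⁺ˡ (∈-map⁺ (inside ∷_) (∈-allSubsets S))
∈-allSubsets (outside ∷ S) = ∈-++⁺ʳ _ (∈-map⁺ (outside ∷_) (∈-allSubsets S))

-- The summands of 𝒫

segment : Fin n → List (Pt n)
segment i = 0ᵖ ∷ e ⁅ i ⁆ ∷ []

properSubsets : Subset n → List (Pt n)
properSubsets {n} I = map e (filter (λ S → T? (⊊ᵇ S I)) (allSubsets n))

module _ {i : Fin n} where

  segment-max-0 : (c : Pt n) → IsMaxVertex (segment i) c 0ᵖ ⇔ c i ≤ 0ℚ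
  segment-max-0 c = mk⇔
    (λ (_ , max) → subst₂ _≤_ (·e-⁅⁆ c i) (·-0ᵖ c) (max (there (here refl))))
    (λ ci≤0 → here refl , λ { (here refl)         → ≤-refl
                            ; (there (here refl)) → subst₂ _≤_ (sym (·e-⁅⁆ c i)) (sym (·-0ᵖ c)) ci≤0 })

  segment-max-e : (c : Pt n) → IsMaxVertex (segment i) c (e ⁅ i ⁆) ⇔ 0ℚ ≤ c i
  segment-max-e c = mk⇔
    (λ (_ , max) → subst₂ _≤_ (·-0ᵖ c) (·e-⁅⁆ c i) (max (here refl)))
    (λ ci≥0 → there (here refl) , λ { (here refl)         → subst₂ _≤_ (sym (·-0ᵖ c)) (sym (·e-⁅⁆ c i)) ci≥0
                                    ; (there (here refl)) → ≤-refl })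

∈-properSubsets⁺ : {I S : Subset n} → S ⊂ I → e S ∈ˡ properSubsets I
∈-properSubsets⁺ {I = I} {S} S⊂I =
  ∈-map⁺ e (∈-filter⁺ (λ S → T? (⊊ᵇ S I)) (∈-allSubsets S) (⊂⇒⊊ᵇ S⊂I))

∈-properSubsets⁻ : {I : Subset n} {p : Pt n} → p ∈ˡ properSubsets I → ∃ λ S → S ⊂ I × p ≡ e S
∈-properSubsets⁻ {n} {I} p∈ with S , S∈ , p≡ ← ∈-map⁻ e p∈ =
  S , ⊊ᵇ⇒⊂ S I (proj₂ (∈-filter⁻ (λ S → T? (⊊ᵇ S I)) {xs = allSubsets n} S∈)) , p≡

maxSubset⇒maxVertex : (c : Pt n) {I S : Subset n} →
  IsMaxSubset c I S → IsMaxVertex (properSubsets I) c (e S)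
maxSubset⇒maxVertex c {I} {S} (S⊂I , max) = ∈-properSubsets⁺ S⊂I , vertex≤
  where
  vertex≤ : ∀ {q} → q ∈ˡ properSubsets I → c · q ≤ c · e S
  vertex≤ q∈ with U , U⊂I , refl ← ∈-properSubsets⁻ q∈ = max U⊂I

maxVertex⇒maxSubset : (c : Pt n) {I S : Subset n} → S ⊂ I →
  IsMaxVertex (properSubsets I) c (e S) → IsMaxSubset c I S
maxVertex⇒maxSubset c S⊂I (_ , max) = S⊂I , λ U⊂I → max (∈-properSubsets⁺ U⊂I)

module _ (ℬ : BuildingSet n) where
  open BuildingSet ℬ

  segment∈summands : ∀ i → Conv (segment i) ∈ˡ summands ℬ
  segment∈summands i = ∈-++⁺ˡ (∈-map⁺ (Conv ∘ segment) (∈-tabulate⁺ {f = id} i))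

  properSubsets∈summands : ∀ I → T (B I) → Conv (properSubsets I) ∈ˡ summands ℬ
  properSubsets∈summands I BI = ∈-++⁺ʳ (map (Conv ∘ segment) (allFins n))
    (∈-map⁺ (Conv ∘ properSubsets) (∈-filter⁺ (λ I → T? (B I)) (∈-allSubsets I) BI))

  data Summand : (Pt n → Set) → Set₁ where
    segmentˢ : ∀ i → Summand (Conv (segment i))
    properˢ  : ∀ I → T (B I) → Summand (Conv (properSubsets I))

  summand : ∀ {A} → A ∈ˡ summands ℬ → Summand A
  summand A∈ with ∈-++⁻ (map (Conv ∘ segment) (allFins n)) A∈
  ... | inj₁ A∈ˢ with i , _ , refl ← ∈-map⁻ (Conv ∘ segment) A∈ˢ = segmentˢ i
  ... | inj₂ A∈ᵖ with I , I∈ , refl ← ∈-map⁻ (Conv ∘ properSubsets) A∈ᵖ =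
    properˢ I (proj₂ (∈-filter⁻ (λ I → T? (B I)) {xs = allSubsets n} I∈))

  Face-summand-nonempty : (c : Pt n) → ∀ {A} → A ∈ˡ summands ℬ → ∃ (Face A c)
  Face-summand-nonempty c A∈ with summand A∈
  ... | segmentˢ i =
    let p , p-max = maxVertex-exists {ps = segment i} c (here refl) in p , maxVertex⇒Face c p-max
  ... | properˢ I BI =
    let i , i∈I   = nonempty I BI
        p , p-max = maxVertex-exists c (∈-properSubsets⁺ (x∈p⇒p-x⊂p i∈I))
    in p , maxVertex⇒Face c p-max

  -- The c-maximal vertices of each summand only depend on the signs of c
  -- and on the argmins of c over the c-positive members of the building set.
  record Refines (c d : Pt n) : Set where
    field
      pos    : ∀ i → 0ℚ < d i → 0ℚ < c i
      neg    : ∀ i → d i < 0ℚ → c i < 0ℚ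
      argmin : ∀ I → T (B I) → (∀ {i} → i ∈ I → 0ℚ < c i) →
               ∀ {i} → IsArgmin c I i → IsArgmin d I i

  -- The segments test `c i ≤ 0` and `0 ≤ c i`, so the sign clauses arise by contraposition; the
  -- vertex `e (I - i)` tests whether `i` is an argmin on `I`.
  Face-mono⇒Refines : (c d : Pt n) → Face (𝒫 ℬ) c ⊑ Face (𝒫 ℬ) d → Refines c d
  Face-mono⇒Refines c d c⊑d = record
    { pos    = λ i di>0 → ≰⇒> λ ci≤0 → <-irrefl refl (<-≤-trans di>0
                 (Equivalence.to (segment-max-0 d) (vertex-mono (segment∈summands i)
                   (Equivalence.from (segment-max-0 c) ci≤0))))
    ; neg    = λ i di<0 → ≰⇒> λ ci≥0 → <-irrefl refl (≤-<-trans
                 (Equivalence.to (segment-max-e d) (vertex-mono (segment∈summands i)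
                   (Equivalence.from (segment-max-e c) ci≥0))) di<0)
    ; argmin = λ I BI c>0 {i} i-min@(i∈I , _) → maxSubset⇒argmin d i∈I
                 (maxVertex⇒maxSubset d (x∈p⇒p-x⊂p i∈I) (vertex-mono (properSubsets∈summands I BI)
                   (maxSubset⇒maxVertex c (argmin⇒maxSubset c (<⇒≤ ∘ c>0) i-min))))
    }
    where
    vertex-mono : ∀ {ps} → Conv ps ∈ˡ summands ℬ → ∀ {p} → IsMaxVertex ps c p → IsMaxVertex ps d p
    vertex-mono ps∈ = Face-Conv-mono⁻ c d
      (Face-summand-mono (summands ℬ) c d (Face-summand-nonempty c) c⊑d ps∈)

  Refines⇒Face-mono : (c d : Pt n) → Refines c d → Face (𝒫 ℬ) c ⊑ Face (𝒫 ℬ) d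
  Refines⇒Face-mono c d refines = Face-Minkowski-mono (summands ℬ) c d λ A∈ → mono (summand A∈)
    where
    open Refines refines

    segment-mono : ∀ {i p} → IsMaxVertex (segment i) c p → IsMaxVertex (segment i) d p
    segment-mono {i} p-max@(here refl , _) = Equivalence.from (segment-max-0 d)
      (≮⇒≥ λ di>0 → <-irrefl refl (<-≤-trans (pos i di>0) (Equivalence.to (segment-max-0 c) p-max)))
    segment-mono {i} p-max@(there (here refl) , _) = Equivalence.from (segment-max-e d)
      (≮⇒≥ λ di<0 → <-irrefl refl (≤-<-trans (Equivalence.to (segment-max-e c) p-max) (neg i di<0)))

    properSubsets-mono : ∀ {I} → T (B I) → ∀ {p} →
      IsMaxVertex (properSubsets I) c p → IsMaxVertex (properSubsets I) d p
    properSubsets-mono {I} BI p-max@(p∈ , _) with S , S⊂I , refl ← ∈-properSubsets⁻ p∈ =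
      maxSubset⇒maxVertex d (maxSubset-mono c d pos neg (argmin I BI) (maxVertex⇒maxSubset c S⊂I p-max))

    mono : ∀ {A} → Summand A → Face A c ⊑ Face A d
    mono (segmentˢ i)   = Face-Conv-mono⁺ c d (segment-mono {i})
    mono (properˢ I BI) = Face-Conv-mono⁺ c d (properSubsets-mono BI)

-- Finite subsets and their unions

module _ {P : Fin n → Set} (P? : Decidable P) where

  comprehension : Subset n
  comprehension = tabulate (⌊_⌋ ∘ P?)

  ∈-comprehension⁺ : ∀ {i} → P i → i ∈ comprehension
  ∈-comprehension⁺ {i} Pi =
    lookup⇒[]= i comprehension (trans (lookup∘tabulate (⌊_⌋ ∘ P?) i) (Equivalence.to T-≡ (fromWitness Pi)))

  ∈-comprehension⁻ : ∀ {i} → i ∈ comprehension → P i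
  ∈-comprehension⁻ {i} i∈ =
    toWitness {a? = P? i} (subst T (trans (sym ([]=⇒lookup i∈)) (lookup∘tabulate (⌊_⌋ ∘ P?) i)) _)

allSubset? : {P : Subset n → Set} → Decidable P → Dec (∀ S → P S)
allSubset? P? = map′ (λ none S → decidable-stable (P? S) λ ¬PS → none (S , ¬PS))
                     (λ all (S , ¬PS) → ¬PS (all S))
                     (¬? (anySubset? (¬? ∘ P?)))

∈-⋃⁺ : {L : List (Subset n)} {K : Subset n} → K ∈ˡ L → K ⊆ ⋃ L
∈-⋃⁺ {L = K ∷ L} (here refl) x∈K = p⊆p∪q (⋃ L) x∈K
∈-⋃⁺ {L = K ∷ L} (there K∈L) x∈K = q⊆p∪q K (⋃ L) (∈-⋃⁺ K∈L x∈K)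

∈-⋃⁻ : (L : List (Subset n)) {x : Fin n} → x ∈ ⋃ L → ∃ λ K → K ∈ˡ L × x ∈ K
∈-⋃⁻ []      x∈⊥ = contradiction x∈⊥ ∉⊥
∈-⋃⁻ (K ∷ L) x∈  with x∈p∪q⁻ K (⋃ L) x∈
... | inj₁ x∈K  = K , here refl , x∈K
... | inj₂ x∈⋃L = let K′ , K′∈L , x∈K′ = ∈-⋃⁻ L x∈⋃L in K′ , there K′∈L , x∈K′

argmin-exists : (c : Pt n) {I : Subset n} → Nonempty I → ∃ (IsArgmin c I)
argmin-exists {n} c {I} (i , i∈I) =
  Extrema.argmin c i elements ,
  Extrema.argmin-all c {P = _∈ I} i∈I (All.all-filter (_∈? I) (allFins n)) ,
  λ j∈I → All.lookup (Extrema.f[argmin]≤f[xs] {f = c} i elements)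
            (∈-filter⁺ (_∈? I) (∈-tabulate⁺ {f = id} _) j∈I)
  where
  elements : List (Fin n)
  elements = filter (_∈? I) (allFins n)

-- The collection attached to a linear functional

module _ (ℬ : BuildingSet n) where
  open BuildingSet ℬ

  -- The members of `L` need not meet each other: each meets `J`, so they can be joined to it one at
  -- a time within `B`.
  B-⋃ : ∀ {J} → T (B J) → (L : List (Subset n)) →
        (∀ {K} → K ∈ˡ L → T (B K) × Nonempty (J ∩ K)) → T (B (J ∪ ⋃ L))
  B-⋃ {J} BJ []      _    = subst (T ∘ B) (sym (∪-identityʳ J)) BJ
  B-⋃ {J} BJ (K ∷ L) meet with BK , x , x∈J∩K ← meet (here refl) =
    subst (T ∘ B) reorder
      (union K (J ∪ ⋃ L) BK (B-⋃ BJ L (meet ∘ there))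
        (let x∈J , x∈K = x∈p∩q⁻ J K x∈J∩K in x , x∈p∩q⁺ (x∈K , p⊆p∪q (⋃ L) x∈J)))
    where
    reorder : K ∪ (J ∪ ⋃ L) ≡ J ∪ (K ∪ ⋃ L)
    reorder = trans (sym (∪-assoc K J (⋃ L)))
                (trans (cong (_∪ ⋃ L) (∪-comm K J)) (∪-assoc J K (⋃ L)))

  -- For nonempty `I`: `J` lies in the superlevel set of `c` at its minimum over `I`. Phrased
  -- without the minimum, this is decidable by search.
  Dominates : Pt n → Subset n → Subset n → Set
  Dominates c I J = ∀ j → j ∈ J → ∃ λ i → i ∈ I × c i ≤ c j

  -- I is a connected component of a superlevel set { c ≥ t } with t > 0 (namely t = min c on I).
  IsComponent : Pt n → Subset n → Set
  IsComponent c I =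
    T (B I) × (∀ i → i ∈ I → 0ℚ < c i) ×
    (∀ J → T (B J) × I ⊆ J × Dominates c I J → J ⊆ I)

  isComponent? : ∀ c → Decidable (IsComponent c)
  isComponent? c I =
    T? (B I) ×-dec all? (λ i → i ∈? I →-dec 0ℚ <? c i) ×-dec
    allSubset? (λ J →
      (T? (B J) ×-dec I ⊆? J ×-dec
        all? (λ j → j ∈? J →-dec any? (λ i → i ∈? I ×-dec c i ≤? c j)))
      →-dec J ⊆? I)

  φ : Pt n → Collection n
  φ c = coll (λ I → ⌊ isComponent? c I ⌋) (comprehension (λ i → c i <? 0ℚ))

  ∈φ⁻ : ∀ c {I} → T (Collection.Is (φ c) I) → IsComponent c I
  ∈φ⁻ c {I} = toWitness {a? = isComponent? c I}

  ∈φ⁺ : ∀ c {I} → IsComponent c I → T (Collection.Is (φ c) I)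
  ∈φ⁺ c {I} = fromWitness {a? = isComponent? c I}

  argmin-dominates : ∀ c {I J m} → IsArgmin c J m → m ∈ I → Dominates c I J
  argmin-dominates c (_ , m-min) m∈I j j∈J = _ , m∈I , m-min j∈J

  φ-extendedNested : ∀ c → IsExtendedNested ℬ (φ c)
  φ-extendedNested c = record
    { inB       = λ I I∈ → proj₁ (∈φ⁻ c I∈)
    ; nested    = λ I J I∈ J∈ → nested (∈φ⁻ c I∈) (∈φ⁻ c J∈)
    ; noUnion   = noUnion
    ; xsOutside = λ i I i∈xs I∈ i∈I →
        <-asym (∈-comprehension⁻ (λ i → c i <? 0ℚ) i∈xs) (proj₁ (proj₂ (∈φ⁻ c I∈)) i i∈I)
    }
    where
    -- A minimum of `c` on `I ∪ J` lies in one of the two sets, which then dominates the union and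
    -- absorbs it by maximality.
    nested : ∀ {I J} → IsComponent c I → IsComponent c J → I ⊆ J ⊎ J ⊆ I ⊎ Disjoint I J
    nested {I} {J} (BI , _ , I-max) (BJ , _ , J-max) with nonempty? (I ∩ J)
    ... | no  disjoint = inj₂ (inj₂ disjoint)
    ... | yes meet with argmin-exists c (nonempty (I ∪ J) (union I J BI BJ meet))
    ... | m , m-min with x∈p∪q⁻ I J (proj₁ m-min)
    ... | inj₁ m∈I = inj₂ (inj₁ λ x∈J → I-max (I ∪ J)
                       (union I J BI BJ meet , p⊆p∪q J , argmin-dominates c m-min m∈I) (q⊆p∪q I J x∈J))
    ... | inj₂ m∈J = inj₁ λ x∈I → J-max (I ∪ J)
                       (union I J BI BJ meet , q⊆p∪q I J , argmin-dominates c m-min m∈J) (p⊆p∪q J x∈I)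

    another : ∀ (L : List (Subset n)) → 2 ℕ.≤ length L → AllPairs Disjoint L →
              ∀ {I} → I ∈ˡ L → ∃ λ J → J ∈ˡ L × Disjoint I J
    another (_ ∷ J ∷ L) _ ((I#J ∷ _) ∷ _) (here refl)  = J , there (here refl) , I#J
    another (_ ∷ [])    (s≤s ()) _ _
    another (J ∷ _ ∷ L) _ (J#L ∷ _)       (there I∈L) =
      J , here refl , λ (x , x∈I∩J) → All.lookup J#L I∈L
        (x , x∈p∩q⁺ (let x∈I , x∈J = x∈p∩q⁻ _ J x∈I∩J in x∈J , x∈I))

    -- The member of `L` holding a minimum of `c` on `⋃ L` dominates the union, so by maximality it
    -- contains another member, which is nonempty yet disjoint from it.
    noUnion : ∀ L → 2 ℕ.≤ length L → All (λ I → T (Collection.Is (φ c) I)) L →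
              AllPairs Disjoint L → ¬ T (B (⋃ L))
    noUnion L 2≤∣L∣ L⊆φ disjoint B⋃ with argmin-exists c (nonempty (⋃ L) B⋃)
    ... | m , m-min with ∈-⋃⁻ L (proj₁ m-min)
    ... | I , I∈L , m∈I with another L 2≤∣L∣ disjoint I∈L
    ... | J , J∈L , I#J with nonempty J (proj₁ (∈φ⁻ c (All.lookup L⊆φ J∈L)))
    ... | x , x∈J = I#J (x , x∈p∩q⁺
      ( proj₂ (proj₂ (∈φ⁻ c (All.lookup L⊆φ I∈L))) (⋃ L)
          (B⋃ , ∈-⋃⁺ I∈L , argmin-dominates c m-min m∈I) (∈-⋃⁺ J∈L x∈J)
      , x∈J ))

  -- `K` is the connected component of `i` in the superlevel set at `c i`: the union of the members
  -- of `B` through `i` on which `c` is at least `c i`. A competitor dominated by `K` is itself one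
  -- of these members.
  component-at : ∀ c i → 0ℚ < c i →
    ∃ λ K → IsComponent c K × i ∈ K × (∀ {k} → k ∈ K → c i ≤ c k)
  component-at c i ci>0 = K , (BK , (λ k k∈K → <-≤-trans ci>0 (K≥ k∈K)) , K-max) , i∈K , K≥
    where
    P? : Decidable (λ J → T (B J) × i ∈ J × (∀ j → j ∈ J → c i ≤ c j))
    P? J = T? (B J) ×-dec i ∈? J ×-dec all? (λ j → j ∈? J →-dec c i ≤? c j)

    L : List (Subset n)
    L = filter P? (allSubsets n)

    K : Subset n
    -- The singleton is the base set met by every member of `L`, as `B-⋃` requires.
    K = ⁅ i ⁆ ∪ ⋃ L

    i∈K : i ∈ K
    i∈K = p⊆p∪q (⋃ L) (x∈⁅x⁆ i)

    BK : T (B K)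
    BK = B-⋃ (singletons i) L λ J∈L →
      let _ , BJ , i∈J , _ = ∈-filter⁻ P? {xs = allSubsets n} J∈L in
      BJ , i , x∈p∩q⁺ (x∈⁅x⁆ i , i∈J)

    K≥ : ∀ {k} → k ∈ K → c i ≤ c k
    K≥ k∈K with x∈p∪q⁻ ⁅ i ⁆ (⋃ L) k∈K
    ... | inj₁ k∈i  rewrite x∈⁅y⁆⇒x≡y i k∈i = ≤-refl
    ... | inj₂ k∈⋃L =
      let J , J∈L , k∈J   = ∈-⋃⁻ L k∈⋃L
          _ , _ , _ , J≥ = ∈-filter⁻ P? {xs = allSubsets n} J∈L
      in J≥ _ k∈J

    K-max : ∀ J → T (B J) × K ⊆ J × Dominates c K J → J ⊆ K
    K-max J (BJ , K⊆J , dom) x∈J = q⊆p∪q ⁅ i ⁆ (⋃ L)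
      (∈-⋃⁺ (∈-filter⁺ P? (∈-allSubsets J)
              (BJ , K⊆J i∈K , λ j j∈J → let k , k∈K , ck≤cj = dom j j∈J in ≤-trans (K≥ k∈K) ck≤cj))
            x∈J)

  -- Let `J` compete with a `d`-component `I` under `c`. A `c`-argmin of `I` is one of `J` too;
  -- refinement makes it a `d`-argmin of `J`, so `I` dominates `J` under `d` as well and `J ⊆ I`.
  Refines⇒φ-mono : ∀ c d → Refines ℬ c d → φ d ⊆ᶜ φ c
  Refines⇒φ-mono c d refines =
    (λ I I∈ → ∈φ⁺ c (component (∈φ⁻ d I∈))) ,
    (λ i∈ → ∈-comprehension⁺ (λ i → c i <? 0ℚ) (neg _ (∈-comprehension⁻ (λ i → d i <? 0ℚ) i∈)))
    where
    open Refines refines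

    component : ∀ {I} → IsComponent d I → IsComponent c I
    component {I} (BI , d>0 , I-max) = BI , c>0 , λ J (BJ , I⊆J , dom) →
      I-max J (BJ , I⊆J , dominates-d J BJ I⊆J dom)
      where
      c>0 : ∀ i → i ∈ I → 0ℚ < c i
      c>0 i i∈I = pos i (d>0 i i∈I)

      dominates-d : ∀ J → T (B J) → I ⊆ J → Dominates c I J → Dominates d I J
      dominates-d J BJ I⊆J dom with m , m∈I , m-min ← argmin-exists c (nonempty I BI) =
        argmin-dominates d
          (argmin J BJ
            (λ {j} j∈J → let i , i∈I , ci≤cj = dom j j∈J in <-≤-trans (c>0 i i∈I) ci≤cj)
            (I⊆J m∈I , λ {j} j∈J → let i , i∈I , ci≤cj = dom j j∈J in ≤-trans (m-min i∈I) ci≤cj))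
          m∈I

  φ-mono⇒Refines : ∀ c d → φ d ⊆ᶜ φ c → Refines ℬ c d
  φ-mono⇒Refines c d (Is⊆ , xs⊆) = record
    { pos    = λ i di>0 → let K , K-comp , i∈K , _ = component-at d i di>0 in
                 proj₁ (proj₂ (component K-comp)) i i∈K
    ; neg    = neg
    ; argmin = λ I BI c>0 {i} i-min@(i∈I , _) → i∈I , λ k∈I → ≮⇒≥ λ dk<di →
                 <-irrefl refl (<-≤-trans dk<di (argmin-≤ I BI c>0 i-min k∈I dk<di))
    }
    where
    component : ∀ {I} → IsComponent d I → IsComponent c I
    component {I} I-comp = ∈φ⁻ c (Is⊆ I (∈φ⁺ d I-comp))

    neg : ∀ i → d i < 0ℚ → c i < 0ℚ
    neg i di<0 = ∈-comprehension⁻ (λ i → c i <? 0ℚ) (xs⊆ (∈-comprehension⁺ (λ i → d i <? 0ℚ) di<0))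

    -- The `d`-component `K` of `i` at level `d i` is also a `c`-component. As `i ∈ K` is a
    -- `c`-argmin of `I`, `K` dominates `K ∪ I`; hence `I ⊆ K`, where `d` is at least `d i`.
    argmin-≤ : ∀ I → T (B I) → (∀ {i} → i ∈ I → 0ℚ < c i) →
               ∀ {i} → IsArgmin c I i → ∀ {k} → k ∈ I → d k < d i → d i ≤ d k
    argmin-≤ I BI c>0 {i} i-min@(i∈I , i≤) {k} k∈I dk<di
      with K , K-comp , i∈K , K≥ ← component-at d i
             -- A negative `d k` would make `c k` negative; hence `0 ≤ d k < d i`, the positivity
             -- that `component-at` asks for.
             (≤-<-trans (≮⇒≥ λ dk<0 → <-asym (neg k dk<0) (c>0 k∈I)) dk<di)
      = K≥ (proj₂ (proj₂ (component K-comp)) (K ∪ I)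
          ( union K I (proj₁ K-comp) BI (i , x∈p∩q⁺ (i∈K , i∈I)) , p⊆p∪q I , dominates )
          (q⊆p∪q K I k∈I))
      where
      dominates : Dominates c K (K ∪ I)
      dominates j j∈K∪I with x∈p∪q⁻ K I j∈K∪I
      ... | inj₁ j∈K = j , j∈K , ≤-refl
      ... | inj₂ j∈I = i , i∈K , i≤ j∈I

-- Every extended nested collection is attached to some functional

ι : ℕ → ℚ
ι zero    = 0ℚ
ι (suc m) = 1ℚ + ι m

ι-<-suc : ∀ k → ι k < ι (suc k)
ι-<-suc k = subst (_< 1ℚ + ι k) (+-identityˡ (ι k)) (+-monoˡ-< (ι k) (positive⁻¹ 1ℚ))

ι-mono-≤ : ∀ {k l} → k ℕ.≤ l → ι k ≤ ι l
ι-mono-≤ {l = zero}  z≤n       = ≤-refl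
ι-mono-≤ {l = suc l} z≤n       = ≤-trans (ι-mono-≤ {l = l} z≤n) (<⇒≤ (ι-<-suc l))
ι-mono-≤             (s≤s k≤l) = +-monoʳ-≤ 1ℚ (ι-mono-≤ k≤l)

ι-mono-< : ∀ {k l} → k ℕ.< l → ι k < ι l
ι-mono-< {k} k<l = <-≤-trans (ι-<-suc k) (ι-mono-≤ k<l)

module _ (ℬ : BuildingSet n) (N : Collection n) (N-nested : IsExtendedNested ℬ N) where
  open BuildingSet ℬ
  open Collection N
  open IsExtendedNested N-nested

  -- Inserting members one at a time keeps the maximal ones: a new `K` either lies in a chosen set,
  -- or is added while the chosen sets inside it are dropped.
  disjointCover : (L : List (Subset n)) → (∀ {K} → K ∈ˡ L → T (Is K)) →
    ∃ λ D → (∀ {K} → K ∈ˡ D → K ∈ˡ L) × AllPairs Disjoint D ×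
            (∀ {K} → K ∈ˡ L → ∃ λ K′ → K′ ∈ˡ D × K ⊆ K′)
  disjointCover []      _   = [] , (λ ()) , [] , λ ()
  disjointCover (K ∷ L) L⊆N
    with D , D⊆L , D-disjoint , D-covers ← disjointCover L (L⊆N ∘ there)
    with Any.any? (K ⊆?_) D
  ... | yes K⊆∈D = D , there ∘ D⊆L , D-disjoint ,
        λ { (here refl) → find K⊆∈D ; (there K′∈L) → D-covers K′∈L }
  ... | no  K⊈∈D = K ∷ D′ , D′⊆L , K#D′ ∷ AllPairs.filter⁺ ⊈K? D-disjoint , covers
    where
    ⊈K? : Decidable (λ K′ → ¬ (K′ ⊆ K))
    ⊈K? K′ = ¬? (K′ ⊆? K)

    D′ : List (Subset n)
    D′ = filter ⊈K? D

    D′⊆L : ∀ {K′} → K′ ∈ˡ K ∷ D′ → K′ ∈ˡ K ∷ L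
    D′⊆L (here K′≡K)  = here K′≡K
    D′⊆L (there K′∈D) = there (D⊆L (proj₁ (∈-filter⁻ ⊈K? {xs = D} K′∈D)))

    -- `K` lies in no chosen set and no surviving set lies in `K`, so nestedness leaves only
    -- disjointness.
    K#D′ : All (Disjoint K) D′
    K#D′ = All.tabulate λ {K′} K′∈D′ →
      let K′∈D , K′⊈K = ∈-filter⁻ ⊈K? {xs = D} K′∈D′ in
      separate K′∈D K′⊈K (nested K K′ (L⊆N (here refl)) (L⊆N (there (D⊆L K′∈D))))
      where
      separate : ∀ {K′} → K′ ∈ˡ D → ¬ (K′ ⊆ K) → K ⊆ K′ ⊎ K′ ⊆ K ⊎ Disjoint K K′ → Disjoint K K′
      separate K′∈D K′⊈K (inj₁ K⊆K′)        = contradiction (lose K′∈D (λ {x} → K⊆K′ {x})) K⊈∈D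
      separate K′∈D K′⊈K (inj₂ (inj₁ K′⊆K)) = contradiction (λ {x} → K′⊆K {x}) K′⊈K
      separate K′∈D K′⊈K (inj₂ (inj₂ K#K′)) = K#K′

    covers : ∀ {K″} → K″ ∈ˡ K ∷ L → ∃ λ K′ → K′ ∈ˡ K ∷ D′ × K″ ⊆ K′
    covers (here refl) = K , here refl , id
    covers (there K″∈L) with K′ , K′∈D , K″⊆K′ ← D-covers K″∈L with K′ ⊆? K
    ... | yes K′⊆K = K , here refl , K′⊆K ∘ K″⊆K′
    ... | no  K′⊈K = K′ , there (∈-filter⁺ ⊈K? K′∈D K′⊈K) , K″⊆K′

  -- The maximal ones among the members meeting J are disjoint and their union with J is in B,
  -- so by noUnion there is only one of them.
  coveringMember : {Q : Subset n → Set} → Decidable Q → ∀ J → T (B J) →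
    (∀ {j} → j ∈ J → ∃ λ K → T (Is K) × Q K × j ∈ K) → ∃ λ K → T (Is K) × Q K × J ⊆ K
  coveringMember {Q} Q? J BJ cover =
    let D , D⊆L , D-disjoint , D-covers = disjointCover L (proj₁ ∘ ∈L⁻) in
    single D (∈L⁻ ∘ D⊆L) D-disjoint λ j∈J →
      let K , KN , QK , j∈K = cover j∈J
          K′ , K′∈D , K⊆K′ = D-covers (∈-filter⁺ P? (∈-allSubsets K) (KN , QK , _ , x∈p∩q⁺ (j∈J , j∈K)))
      in K′ , K′∈D , K⊆K′ j∈K
    where
    -- `Q` is imposed before the maximal members are taken, so the one that remains satisfies it.
    P? : Decidable (λ K → T (Is K) × Q K × Nonempty (J ∩ K))
    P? K = T? (Is K) ×-dec Q? K ×-dec nonempty? (J ∩ K)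

    L : List (Subset n)
    L = filter P? (allSubsets n)

    ∈L⁻ : ∀ {K} → K ∈ˡ L → T (Is K) × Q K × Nonempty (J ∩ K)
    ∈L⁻ K∈L = proj₂ (∈-filter⁻ P? {xs = allSubsets n} K∈L)

    single : ∀ D → (∀ {K} → K ∈ˡ D → T (Is K) × Q K × Nonempty (J ∩ K)) → AllPairs Disjoint D →
             (∀ {j} → j ∈ J → ∃ λ K → K ∈ˡ D × j ∈ K) → ∃ λ K → T (Is K) × Q K × J ⊆ K
    single []      _  _ D-covers with _ , () , _ ← D-covers (proj₂ (nonempty J BJ))
    single (K ∷ []) D⊆ _ D-covers = let KN , QK , _ = D⊆ (here refl) in K , KN , QK , J⊆K
      where
      J⊆K : J ⊆ K
      J⊆K j∈J with D-covers j∈J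
      ... | _ , here refl , j∈K = j∈K
    -- Joining all of `D` to `J` stays in `B`; since `D` covers `J`, the result is just `⋃ D`, which
    -- `noUnion` excludes.
    single D@(_ ∷ _ ∷ _) D⊆ D-disjoint D-covers =
      contradiction (subst (T ∘ B) J∪⋃D≡⋃D B[J∪⋃D])
        (noUnion D (s≤s (s≤s z≤n)) (All.tabulate (proj₁ ∘ D⊆)) D-disjoint)
      where
      B[J∪⋃D] : T (B (J ∪ ⋃ D))
      B[J∪⋃D] = B-⋃ ℬ BJ D λ K∈D → let KN , _ , meet = D⊆ K∈D in inB _ KN , meet

      J∪⋃D⊆⋃D : J ∪ ⋃ D ⊆ ⋃ D
      J∪⋃D⊆⋃D x∈ with x∈p∪q⁻ J (⋃ D) x∈
      ... | inj₁ x∈J  = let _ , K∈D , x∈K = D-covers x∈J in ∈-⋃⁺ K∈D x∈K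
      ... | inj₂ x∈⋃D = x∈⋃D

      J∪⋃D≡⋃D : J ∪ ⋃ D ≡ ⋃ D
      J∪⋃D≡⋃D = ⊆-antisym J∪⋃D⊆⋃D (q⊆p∪q J (⋃ D))

  -- The functional of an extended nested collection

  weight : Subset n → ℕ
  -- With `suc n` the weight is positive even for the full set, which reserves 0 for elements in no
  -- member.
  weight K = suc n ∸ ∣ K ∣

  weight>0 : ∀ K → 0ℚ < ι (weight K)
  weight>0 K = ι-mono-< (ℕ.m<n⇒0<n∸m (s≤s (∣p∣≤n K)))

  weight-antimono-⊂ : ∀ {I K} → I ⊂ K → ι (weight K) < ι (weight I)
  weight-antimono-⊂ {I} {K} I⊂K =
    ι-mono-< (ℕ.∸-monoʳ-< (p⊂q⇒∣p∣<∣q∣ I⊂K) (ℕ.m≤n⇒m≤1+n (∣p∣≤n K)))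

  private
    memberAt? : ∀ i → Decidable (λ K → T (Is K) × i ∈ K)
    memberAt? i K = T? (Is K) ×-dec i ∈? K

  weightsAt : Fin n → List ℕ
  weightsAt i = map weight (filter (memberAt? i) (allSubsets n))

  -- The members containing `i` form a chain, so the largest weight is that of the smallest one; the
  -- default 0 is for the case of none.
  height : Fin n → ℕ
  height i = ExtremaNat.max 0 (weightsAt i)

  functional : Pt n
  functional i = if ⌊ i ∈? xs ⌋ then - 1ℚ else ι (height i)

  functional-∈xs : ∀ {i} → i ∈ xs → functional i ≡ - 1ℚ
  functional-∈xs {i} i∈xs with i ∈? xs
  ... | yes _    = refl
  ... | no  i∉xs = contradiction i∈xs i∉xs

  functional-∉xs : ∀ {i} → i ∉ xs → functional i ≡ ι (height i)
  functional-∉xs {i} i∉xs with i ∈? xs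
  ... | yes i∈xs = contradiction i∈xs i∉xs
  ... | no  _    = refl

  negative⇔∈xs : ∀ {i} → functional i < 0ℚ ⇔ i ∈ xs
  negative⇔∈xs {i} = mk⇔
    (λ fi<0 → decidable-stable (i ∈? xs) λ i∉xs →
      <-irrefl refl (≤-<-trans (ι-mono-≤ {l = height i} z≤n) (subst (_< 0ℚ) (functional-∉xs i∉xs) fi<0)))
    (λ i∈xs → subst (_< 0ℚ) (sym (functional-∈xs i∈xs)) (negative⁻¹ (- 1ℚ)))

  weight≤functional : ∀ {K i} → T (Is K) → i ∈ K → ι (weight K) ≤ functional i
  weight≤functional {K} {i} KN i∈K =
    subst (ι (weight K) ≤_) (sym (functional-∉xs λ i∈xs → xsOutside i K i∈xs KN i∈K))
      (ι-mono-≤ (All.lookup (ExtremaNat.xs≤max 0 (weightsAt i))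
        (∈-map⁺ weight (∈-filter⁺ (memberAt? i) (∈-allSubsets K) (KN , i∈K)))))

  functional-attained : ∀ i → 0ℚ < functional i →
    ∃ λ K → T (Is K) × i ∈ K × functional i ≡ ι (weight K)
  functional-attained i fi>0 = attained (ExtremaNat.argmax-sel id 0 (weightsAt i))
    where
    fi≡ : functional i ≡ ι (height i)
    fi≡ = functional-∉xs λ i∈xs → <-asym fi>0 (Equivalence.from negative⇔∈xs i∈xs)

    attained : height i ≡ 0 ⊎ height i ∈ˡ weightsAt i →
               ∃ λ K → T (Is K) × i ∈ K × functional i ≡ ι (weight K)
    attained (inj₁ h≡0) = contradiction fi>0 (<-irrefl (sym (trans fi≡ (cong ι h≡0))))
    attained (inj₂ h∈)  with K , K∈ , h≡ ← ∈-map⁻ weight h∈ =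
      let _ , KN , i∈K = ∈-filter⁻ (memberAt? i) {xs = allSubsets n} K∈ in
      K , KN , i∈K , trans fi≡ (cong ι h≡)

  -- Each element of `J` lies in a member whose weight is its value, hence at least `t`. With this
  -- bound as `Q`, a single such member contains `J`.
  coveringMember-≥ : ∀ {t} → 0ℚ < t → ∀ J → T (B J) → (∀ {j} → j ∈ J → t ≤ functional j) →
    ∃ λ K → T (Is K) × t ≤ ι (weight K) × J ⊆ K
  coveringMember-≥ {t} t>0 J BJ J≥t = coveringMember (λ K → t ≤? ι (weight K)) J BJ λ {j} j∈J →
    let K , KN , j∈K , fj≡ = functional-attained j (<-≤-trans t>0 (J≥t j∈J)) in
    K , KN , subst (t ≤_) fj≡ (J≥t j∈J) , j∈K

  -- A `J` dominated by `I` has values at least `ι (weight I)`, so it fits into a member `K` of at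
  -- least that weight. As `I ⊆ J ⊆ K`, a point of `J` outside `I` would make the weight of `K`
  -- strictly smaller.
  member⇒component : ∀ {I} → T (Is I) → IsComponent ℬ functional I
  member⇒component {I} IN =
    inB I IN , (λ i i∈I → <-≤-trans (weight>0 I) (weight≤functional IN i∈I)) , I-max
    where
    I-max : ∀ J → T (B J) × I ⊆ J × Dominates ℬ functional I J → J ⊆ I
    I-max J (BJ , I⊆J , dom) {x} x∈J
      with K , _ , I≤K , J⊆K ← coveringMember-≥ (weight>0 I) J BJ (λ {j} j∈J →
             let i , i∈I , fi≤fj = dom j j∈J in ≤-trans (weight≤functional IN i∈I) fi≤fj)
      = decidable-stable (x ∈? I) λ x∉I →
          <-irrefl refl (<-≤-trans (weight-antimono-⊂ (J⊆K ∘ I⊆J , x , J⊆K x∈J , x∉I)) I≤K)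

  -- With the minimum over `I` as threshold, the covering member `K` is dominated by `I`, so
  -- maximality turns `I ⊆ K` into equality.
  component⇒member : ∀ {I} → IsComponent ℬ functional I → T (Is I)
  component⇒member {I} (BI , f>0 , I-max) =
    let m , m∈I , m-min     = argmin-exists functional (nonempty I BI)
        K , KN , m≤K , I⊆K = coveringMember-≥ (f>0 m m∈I) I BI m-min
        K⊆I                = I-max K (inB K KN , I⊆K ,
                               λ j j∈K → m , m∈I , ≤-trans m≤K (weight≤functional KN j∈K))
    in subst (T ∘ Is) (⊆-antisym K⊆I I⊆K) KN

  φ-functional : (φ ℬ functional ⊆ᶜ N) × (N ⊆ᶜ φ ℬ functional)
  φ-functional =
    ( (λ I I∈ → component⇒member (∈φ⁻ ℬ functional I∈))
    , λ i∈ → Equivalence.to negative⇔∈xs (∈-comprehension⁻ (λ i → functional i <? 0ℚ) i∈) ) ,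
    ( (λ I IN → ∈φ⁺ ℬ functional (member⇒component IN))
    , λ i∈xs → ∈-comprehension⁺ (λ i → functional i <? 0ℚ) (Equivalence.from negative⇔∈xs i∈xs) )

-- The nonempty faces of `𝒫` are the sets `Face (𝒫 ℬ) c`, rational `c` sufficing as the vertices are
-- rational. The clauses make `φ` an inclusion-reversing bijection from them to the extended nested
-- collections, which index the nonempty faces of the extended nestohedron in the same reversed
-- order; adjoining the empty face gives the lattice isomorphism.
theorem3p6 : ∀ (n : ℕ) (ℬ : BuildingSet n) →
    Σ (Pt n → Collection n) λ φ →
    (∀ c → IsExtendedNested ℬ (φ c)) ×
    (∀ N → IsExtendedNested ℬ N → ∃ λ c → (φ c ⊆ᶜ N) × (N ⊆ᶜ φ c)) ×
    (∀ c d → (Face (𝒫 ℬ) c ⊑ Face (𝒫 ℬ) d) ⇔ (φ d ⊆ᶜ φ c))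
theorem3p6 n ℬ =
  φ ℬ ,
  φ-extendedNested ℬ ,
  (λ N N-nested → functional ℬ N N-nested , φ-functional ℬ N N-nested) ,
  λ c d → mk⇔ (λ c⊑d → Refines⇒φ-mono ℬ c d (Face-mono⇒Refines ℬ c d c⊑d))
              (λ φd⊆φc → Refines⇒Face-mono ℬ c d (φ-mono⇒Refines ℬ c d φd⊆φc))
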